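{- For every $n\ge 5$, the graph ($1$-skeleton) of the $n$-dimensional cube is dimensionally ambiguous: there are two polytopes of different dimensions whose $1$-skeleta are both combinatorially equivalent to the $1$-skeleton of the $n$-cube.
   Context: The $k$-skeleton of a convex polytope is the polytopal complex formed by its faces of dimension at most $k$. Two complexes are combinatorially equivalent if their face posets are isomorphic. If a $d$-polytope $P$ and a $d'$-polytope $P'$ with $d\ne d'$ have combinatorially equivalent $k$-skeleta, then this $k$-skeleton is called dimensionally ambiguous. -}

module Defs where

open import Level using (0ℓ)
open import Algebra.Bundles using (CommutativeRing)
open import Data.Nat.Base as ℕ using (ℕ)
open import Data.Fin.Base using (Fin; finToFun) renaming (zero to fzero; suc to fsuc)
open import Data.Product using (Σ-syntax; ∃-syntax; _×_; proj₁)
open import Data.Sum using (_⊎_)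
open import Relation.Nullary using (¬_)
open import Relation.Unary using (Pred; _∈_; _≐′_; Empty)
open import Relation.Unary.Relation.Binary.Subset using (⊆′-poset)
open import Relation.Binary.Core using (Rel)
open import Relation.Binary.Bundles using (Poset)
open import Relation.Binary.Structures using (IsDecTotalOrder)
import Relation.Binary.Construct.On as On
open import Relation.Binary.Morphism.Structures using (IsOrderIsomorphism)
open import Relation.Binary.PropositionalEquality using (_≢_)
import Algebra.Properties.CommutativeMonoid.Sum as Sum

-- The real numbers, given axiomatically: a Dedekind-complete ordered field,
-- which is unique up to isomorphism.  The order is taken to be decidable, as
-- it is classically.
record RealField : Set₁ where
  infix 4 _≤_
  field
    commutativeRing : CommutativeRing 0ℓ 0ℓ

  open CommutativeRing commutativeRing public

  field
    _≤_             : Rel Carrier 0ℓ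
    isDecTotalOrder : IsDecTotalOrder _≈_ _≤_
    +-monoˡ-≤       : ∀ z {x y} → x ≤ y → x + z ≤ y + z
    *-nonNeg        : ∀ {x y} → 0# ≤ x → 0# ≤ y → 0# ≤ x * y
    0≉1             : ¬ (0# ≈ 1#)
    inverse         : ∀ x → ¬ (x ≈ 0#) → ∃[ y ] x * y ≈ 1#

  UpperBound : Pred Carrier 0ℓ → Pred Carrier 0ℓ
  UpperBound S b = ∀ x → x ∈ S → x ≤ b

  field
    supremum : (S : Pred Carrier 0ℓ) → (∃[ x ] x ∈ S) → (∃[ b ] UpperBound S b) →
               ∃[ s ] UpperBound S s × (∀ b → UpperBound S b → s ≤ b)

-- Combinatorial equivalence, for face posets.
_≅_ : Poset 0ℓ 0ℓ 0ℓ → Poset 0ℓ 0ℓ 0ℓ → Set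
X ≅ Y = Σ[ f ∈ (X.Carrier → Y.Carrier) ]
        IsOrderIsomorphism X._≈_ Y._≈_ X._≤_ Y._≤_ f
  where
  module X = Poset X
  module Y = Poset Y

module Polytopes (𝓡 : RealField) where

  open RealField 𝓡 renaming (Carrier to ℝ)
  open Sum +-commutativeMonoid using (sum)

  Point : ℕ → Set
  Point m = Fin m → ℝ

  _≋_ : ∀ {m} → Rel (Point m) 0ℓ
  x ≋ y = ∀ j → x j ≈ y j

  _·_ : ∀ {m} → Point m → Point m → ℝ
  c · x = sum (λ j → c j * x j)

  combination : ∀ {r m} → (Fin r → ℝ) → (Fin r → Point m) → Point m
  combination a p j = sum (λ i → a i * p i j)

  convexHull : ∀ {r m} → (Fin r → Point m) → Pred (Point m) 0ℓ
  convexHull p x = ∃[ a ] (∀ i → 0# ≤ a i) × sum a ≈ 1# × x ≋ combination a p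

  affineSpan : ∀ {r m} → (Fin r → Point m) → Pred (Point m) 0ℓ
  affineSpan p x = ∃[ a ] sum a ≈ 1# × x ≋ combination a p

  affineHull : ∀ {m} → Pred (Point m) 0ℓ → Pred (Point m) 0ℓ
  affineHull {m} S x =
    ∃[ r ] Σ[ p ∈ (Fin r → Point m) ] (∀ i → p i ∈ S) × x ∈ affineSpan p

  AffinelyIndependent : ∀ {r m} → (Fin r → Point m) → Set
  AffinelyIndependent {r} p =
    (a : Fin r → ℝ) → sum a ≈ 0# → combination a p ≋ (λ _ → 0#) →
    ∀ i → a i ≈ 0#

  -- The dimension of S is that of its affine hull, and an affine space of
  -- dimension d has an affine basis of d + 1 points.
  HasDim : ∀ {m} → Pred (Point m) 0ℓ → ℕ → Set
  HasDim {m} S d =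
    Σ[ p ∈ (Fin (ℕ.suc d) → Point m) ]
      AffinelyIndependent p × affineSpan p ≐′ affineHull S

  -- The empty set has dimension -1.
  DimAtMost : ∀ {m} → Pred (Point m) 0ℓ → ℕ → Set
  DimAtMost S k = Empty S ⊎ (∃[ d ] d ℕ.≤ k × HasDim S d)

  -- The generating points may include points that are not vertices, and
  -- repetitions; the polytope need not be full-dimensional.
  record Polytope : Set where
    field
      {ambient} : ℕ
      {size}    : ℕ
      points    : Fin size → Point ambient

    ⟦_⟧ : Pred (Point ambient) 0ℓ
    ⟦_⟧ = convexHull points

  open Polytope public

  -- A face is given by a valid linear inequality c · x ≤ b, and consists of
  -- the points of P attaining equality.  The empty face (c = 0, b = 1) and P
  -- itself (c = 0, b = 0) are included.
  record Face (P : Polytope) : Set where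
    field
      normal : Point (ambient P)
      bound  : ℝ
      valid  : ∀ x → x ∈ ⟦ P ⟧ → normal · x ≤ bound

    region : Pred (Point (ambient P)) 0ℓ
    region x = x ∈ ⟦ P ⟧ × normal · x ≈ bound

  open Face public

  -- The face poset of the k-skeleton: faces of dimension at most k, ordered by
  -- inclusion.  Equality is equality of point sets, so different inequalities
  -- (and different dimension witnesses) may represent the same face.
  skeleton : ℕ → Polytope → Poset 0ℓ 0ℓ 0ℓ
  skeleton k P = On.poset (⊆′-poset (Point (ambient P)) 0ℓ) toRegion
    where
    toRegion : (Σ[ F ∈ Face P ] DimAtMost (region F) k) → Pred (Point (ambient P)) 0ℓ
    toRegion F = region (proj₁ F)

  -- [0,1]ⁿ, as the convex hull of the points of {0,1}ⁿ.
  cube : ℕ → Polytope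
  cube n = record
    { ambient = n
    ; size    = 2 ℕ.^ n
    ; points  = λ v j → coordinate (finToFun v j)
    }
    where
    coordinate : Fin 2 → ℝ
    coordinate fzero        = 0#
    coordinate (fsuc fzero) = 1#

  -- For the face poset X of a k-skeleton.
  DimensionallyAmbiguous : ℕ → Poset 0ℓ 0ℓ 0ℓ → Set
  DimensionallyAmbiguous k X =
    Σ[ P ∈ Polytope ] Σ[ P′ ∈ Polytope ] ∃[ d ] ∃[ d′ ]
      HasDim ⟦ P ⟧ d × HasDim ⟦ P′ ⟧ d′ × d ≢ d′ ×
      skeleton k P ≅ X × skeleton k P′ ≅ X

{-# OPTIONS --safe #-}

-- The (n-1)-polytope is the convex hull of the points with coordinates
-- ± s_l(t), for all signs and t ∈ {0,1}, where the scale s_l is 1 at t = 0 and 2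
-- at t = 1 for l = 0, 1, the other way round for l = 2, 3, and constantly 1
-- for l ≥ 4.  It is a projection of a deformed n-cube along the direction of t
-- that preserves all edges.  The inequalities ± x_l ≤ 2 (l < 4), ± x_l ≤ 1 (l ≥ 4)
-- and ± x_l ± x_m ≤ 3 (l ∈ {0,1}, m ∈ {2,3}) cut out every vertex and every
-- edge of the cube graph.  Conversely a face containing two vertices that differ
-- in more than one bit contains a third one, hence has dimension at least 2:
-- a face with three vertices cannot lie on a line.

module Submission where

open import Defs
open import Level using (0ℓ)
open import Data.Nat.Base as ℕ using (ℕ; zero; suc; _^_; _≥_; z≤n; s≤s)
open import Data.Nat.Properties as ℕ using (1+n≢n)
open import Data.Fin.Base using (Fin; zero; suc; finToFun; funToFin; combine; opposite)
open import Data.Fin.Patterns using (0F; 1F; 2F; 3F)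
open import Data.Fin.Properties as Fin using ()
open import Data.Vec.Functional using (updateAt)
open import Data.Vec.Functional.Properties using (updateAt-updates; updateAt-minimal)
open import Data.Product using (Σ-syntax; ∃-syntax; _×_; _,_; proj₁; proj₂)
open import Data.Sum using (_⊎_; inj₁; inj₂; [_,_]′)
open import Data.Bool.Base using (if_then_else_)
open import Function.Base using (_∘_)
open import Relation.Nullary using (¬_; Dec; yes; no; does; contradiction)
open import Relation.Nullary.Decidable using (decidable-stable; _×-dec_; _→-dec_; ¬?)
open import Relation.Unary using (Pred; _∈_; _⊆′_)
open import Relation.Binary.Core using (Rel)
open import Relation.Binary.Bundles using (DecTotalOrder)
open import Relation.Binary.PropositionalEquality as ≡ using (_≡_; _≢_; _≗_)
import Algebra.Properties.Ring as RingProperties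
import Algebra.Properties.AbelianGroup as AbelianGroupProperties
import Algebra.Properties.CommutativeSemigroup as CommutativeSemigroupProperties
import Algebra.Properties.Semiring.Sum as SemiringSum
import Relation.Binary.Reasoning.PartialOrder as PartialOrderReasoning

-- Both polytopes are generated by points indexed by the same bit strings. A convex combination
-- attains the bound of a valid inequality only through generators that attain it, so a face is
-- determined by its set of tight indices, and the isomorphism of skeleta sends a face to one with
-- the same tight set. The number 5 comes from the scales. To fix the sign of a scaled coordinate
-- along an edge in direction t, an inequality must be tight for both values of t; adding a
-- coordinate with the opposite scales does this, as the two scales add up to 1 + 2 at either t. To
-- fix t itself, a coordinate is taken that has scale 2 at that t only. In both cases the auxiliary
-- coordinate must keep its sign along the edge, but the edge may flip exactly that sign. A second
-- coordinate with the same scales is then available: two kinds of scale, two coordinates of each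
-- kind, and the bit t make five bits. The cube fits the same scheme with all scales equal to 1, so
-- the absence of further edges is proved for both polytopes at once.

-- Ordered field arithmetic and finite sums.

module OrderedField (𝓡 : RealField) where

  open RealField 𝓡 hiding (zero) renaming (Carrier to ℝ)
  open RingProperties ring public using (-‿distribˡ-*; -‿distribʳ-*; -0#≈0#; -‿involutive)
  open AbelianGroupProperties +-abelianGroup public using (xyx⁻¹≈y)
    renaming (∙-cancelʳ to +-cancelʳ; ∙-cancelˡ to +-cancelˡ)
  open CommutativeSemigroupProperties *-commutativeSemigroup public using (x∙yz≈y∙xz)

  decTotalOrder : DecTotalOrder 0ℓ 0ℓ 0ℓ
  decTotalOrder = record { isDecTotalOrder = isDecTotalOrder }

  open DecTotalOrder decTotalOrder public using (_≟_; total)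
    renaming (refl to ≤-refl; reflexive to ≤-reflexive; trans to ≤-trans; antisym to ≤-antisym)
  module ≤-Reasoning = PartialOrderReasoning (DecTotalOrder.poset decTotalOrder)

  +-monoʳ-≤ : ∀ z {x y} → x ≤ y → z + x ≤ z + y
  +-monoʳ-≤ z {x} {y} x≤y = begin
    z + x ≈⟨ +-comm z x ⟩
    x + z ≤⟨ +-monoˡ-≤ z x≤y ⟩
    y + z ≈⟨ +-comm y z ⟩
    z + y ∎
    where open ≤-Reasoning

  +-mono-≤ : ∀ {x y u v} → x ≤ y → u ≤ v → x + u ≤ y + v
  +-mono-≤ x≤y u≤v = ≤-trans (+-monoˡ-≤ _ x≤y) (+-monoʳ-≤ _ u≤v)

  +-cancelʳ-≤ : ∀ z {x y} → x + z ≤ y + z → x ≤ y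
  +-cancelʳ-≤ z {x} {y} x+z≤y+z = begin
    x             ≈⟨ +z-z x ⟨
    x + z + - z   ≤⟨ +-monoˡ-≤ (- z) x+z≤y+z ⟩
    y + z + - z   ≈⟨ +z-z y ⟩
    y             ∎
    where
    open ≤-Reasoning
    +z-z : ∀ x → x + z + - z ≈ x
    +z-z x = trans (+-assoc x z (- z)) (trans (+-congˡ (-‿inverseʳ z)) (+-identityʳ x))

  +-tightˡ : ∀ {x y u v} → x ≤ y → u ≤ v → x + u ≈ y + v → x ≈ y
  +-tightˡ {x} {y} {u} {v} x≤y u≤v eq = ≤-antisym x≤y (+-cancelʳ-≤ u (begin
    y + u ≤⟨ +-monoʳ-≤ y u≤v ⟩
    y + v ≈⟨ eq ⟨
    x + u ∎))
    where open ≤-Reasoning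

  +-tightʳ : ∀ {x y u v} → x ≤ y → u ≤ v → x + u ≈ y + v → u ≈ v
  +-tightʳ x≤y u≤v eq = +-tightˡ u≤v x≤y (trans (+-comm _ _) (trans eq (+-comm _ _)))

  neg-mono-≤ : ∀ {x y} → x ≤ y → - y ≤ - x
  neg-mono-≤ {x} {y} x≤y = +-cancelʳ-≤ y (begin
    - y + y ≈⟨ -‿inverseˡ y ⟩
    0#      ≈⟨ -‿inverseˡ x ⟨
    - x + x ≤⟨ +-monoʳ-≤ (- x) x≤y ⟩
    - x + y ∎)
    where open ≤-Reasoning

  *-monoˡ-≤ : ∀ {z x y} → 0# ≤ z → x ≤ y → z * x ≤ z * y
  *-monoˡ-≤ {z} {x} {y} 0≤z x≤y = +-cancelʳ-≤ (- (z * x)) (begin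
    z * x + - (z * x) ≈⟨ -‿inverseʳ (z * x) ⟩
    0#                ≤⟨ *-nonNeg 0≤z 0≤y-x ⟩
    z * (y + - x)     ≈⟨ distribˡ z y (- x) ⟩
    z * y + z * - x   ≈⟨ +-congˡ (-‿distribʳ-* z x) ⟨
    z * y + - (z * x) ∎)
    where
    open ≤-Reasoning
    0≤y-x : 0# ≤ y + - x
    0≤y-x = ≤-trans (≤-reflexive (sym (-‿inverseʳ x))) (+-monoˡ-≤ (- x) x≤y)

  *-antimonoˡ-≤ : ∀ {z x y} → z ≤ 0# → x ≤ y → z * y ≤ z * x
  *-antimonoˡ-≤ {z} {x} {y} z≤0 x≤y = begin
    z * y         ≈⟨ -‿involutive (z * y) ⟨
    - - (z * y)   ≈⟨ -‿cong (-‿distribˡ-* z y) ⟩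
    - (- z * y)   ≤⟨ neg-mono-≤ (*-monoˡ-≤ 0≤-z x≤y) ⟩
    - (- z * x)   ≈⟨ -‿cong (-‿distribˡ-* z x) ⟨
    - - (z * x)   ≈⟨ -‿involutive (z * x) ⟩
    z * x         ∎
    where
    open ≤-Reasoning
    0≤-z : 0# ≤ - z
    0≤-z = ≤-trans (≤-reflexive (sym -0#≈0#)) (neg-mono-≤ z≤0)

  *-cancelˡ : ∀ {z x y} → ¬ z ≈ 0# → z * x ≈ z * y → x ≈ y
  *-cancelˡ {z} {x} {y} z≉0 zx≈zy with inverse z z≉0
  ... | w , zw≈1 = begin-equality
    x           ≈⟨ w*z* x ⟨
    w * (z * x) ≈⟨ *-congˡ zx≈zy ⟩
    w * (z * y) ≈⟨ w*z* y ⟩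
    y           ∎
    where
    open ≤-Reasoning
    w*z* : ∀ x → w * (z * x) ≈ x
    w*z* x = trans (sym (*-assoc w z x)) (trans (*-congʳ (trans (*-comm w z) zw≈1)) (*-identityˡ x))

  0≤1 : 0# ≤ 1#
  0≤1 with total 0# 1#
  ... | inj₁ 0≤1 = 0≤1
  ... | inj₂ 1≤0 = begin
    0#        ≈⟨ zeroʳ 1# ⟨
    1# * 0#   ≤⟨ *-antimonoˡ-≤ 1≤0 1≤0 ⟩
    1# * 1#   ≈⟨ *-identityˡ 1# ⟩
    1#        ∎
    where open ≤-Reasoning

  2# : ℝ
  2# = 1# + 1#

  1≤2 : 1# ≤ 2#
  1≤2 = ≤-trans (≤-reflexive (sym (+-identityˡ 1#))) (+-monoˡ-≤ 1# 0≤1)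

  0≤2 : 0# ≤ 2#
  0≤2 = ≤-trans 0≤1 1≤2

  1≉0 : ¬ 1# ≈ 0#
  1≉0 = 0≉1 ∘ sym

  1≉2 : ¬ 1# ≈ 2#
  1≉2 1≈2 = 0≉1 (+-cancelʳ 1# 0# 1# (trans (+-identityˡ 1#) 1≈2))

  2≉0 : ¬ 2# ≈ 0#
  2≉0 2≈0 = 0≉1 (≤-antisym 0≤1 (≤-trans 1≤2 (≤-reflexive 2≈0)))

  -x≤x : ∀ {x} → 0# ≤ x → - x ≤ x
  -x≤x 0≤x = ≤-trans (neg-mono-≤ 0≤x) (≤-trans (≤-reflexive -0#≈0#) 0≤x)

  -x≈x⇒x≈0 : ∀ {x} → 0# ≤ x → - x ≈ x → x ≈ 0#
  -x≈x⇒x≈0 {x} 0≤x -x≈x = ≤-antisym (begin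
    x   ≈⟨ -x≈x ⟨
    - x ≤⟨ neg-mono-≤ 0≤x ⟩
    - 0# ≈⟨ -0#≈0# ⟩
    0#  ∎) 0≤x
    where open ≤-Reasoning

  open SemiringSum semiring public
    using (sum; sum-cong-≋; ∑-distrib-+; ∑-comm; *-distribˡ-sum; *-distribʳ-sum; sum-replicate-zero)

  sum-zero : ∀ {n} {f : Fin n → ℝ} → (∀ i → f i ≈ 0#) → sum f ≈ 0#
  sum-zero {n} f≈0 = trans (sum-cong-≋ f≈0) (sum-replicate-zero n)

  sum-mono-≤ : ∀ {n} {f g : Fin n → ℝ} → (∀ i → f i ≤ g i) → sum f ≤ sum g
  sum-mono-≤ {zero}  f≤g = ≤-refl
  sum-mono-≤ {suc n} f≤g = +-mono-≤ (f≤g zero) (sum-mono-≤ (f≤g ∘ suc))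

  -- No term can make up for the slack of another. This is behind every argument that splits a tight
  -- sum into tight parts.
  sum-tight : ∀ {n} {f g : Fin n → ℝ} → (∀ i → f i ≤ g i) → sum f ≈ sum g → ∀ i → f i ≈ g i
  sum-tight f≤g eq zero    = +-tightˡ (f≤g zero) (sum-mono-≤ (f≤g ∘ suc)) eq
  sum-tight f≤g eq (suc i) = sum-tight (f≤g ∘ suc) (+-tightʳ (f≤g zero) (sum-mono-≤ (f≤g ∘ suc)) eq) i

  δ : ∀ {n} → Fin n → Fin n → ℝ
  δ zero    zero    = 1#
  δ zero    (suc _) = 0#
  δ (suc _) zero    = 0#
  δ (suc i) (suc j) = δ i j

  0≤δ : ∀ {n} (i j : Fin n) → 0# ≤ δ i j
  0≤δ zero    zero    = 0≤1
  0≤δ zero    (suc _) = ≤-refl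
  0≤δ (suc _) zero    = ≤-refl
  0≤δ (suc i) (suc j) = 0≤δ i j

  δ-refl : ∀ {n} (i : Fin n) → δ i i ≈ 1#
  δ-refl zero    = refl
  δ-refl (suc i) = δ-refl i

  δ-≢ : ∀ {n} {i j : Fin n} → i ≢ j → δ i j ≈ 0#
  δ-≢ {i = zero}  {zero}  i≢j = contradiction ≡.refl i≢j
  δ-≢ {i = zero}  {suc _} i≢j = refl
  δ-≢ {i = suc _} {zero}  i≢j = refl
  δ-≢ {i = suc _} {suc _} i≢j = δ-≢ (i≢j ∘ ≡.cong suc)

  sum-δ : ∀ {n} (i : Fin n) (f : Fin n → ℝ) → sum (λ j → δ i j * f j) ≈ f i
  sum-δ zero    f = trans (+-cong (*-identityˡ _) (sum-zero (λ j → zeroˡ (f (suc j))))) (+-identityʳ _)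
  sum-δ (suc i) f = trans (+-cong (zeroˡ _) (sum-δ i (f ∘ suc))) (+-identityˡ _)

  sum-δ-one : ∀ {n} (i : Fin n) → sum (δ i) ≈ 1#
  sum-δ-one i = trans (sum-cong-≋ (λ j → sym (*-identityʳ (δ i j)))) (sum-δ i (λ _ → 1#))

module Skeleta (𝓡 : RealField) where

  open RealField 𝓡 hiding (zero) renaming (Carrier to ℝ)
  open OrderedField 𝓡
  open Polytopes 𝓡 hiding (normal; bound; valid)
  open ≤-Reasoning

  -- Affine hulls and dimension

  ·-congʳ : ∀ {m} (c : Point m) {x y : Point m} → x ≋ y → c · x ≈ c · y
  ·-congʳ c x≋y = sum-cong-≋ (λ j → *-congˡ (x≋y j))

  ·-combination : ∀ {r m} (c : Point m) (a : Fin r → ℝ) (p : Fin r → Point m) →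
                  c · combination a p ≈ sum (λ i → a i * (c · p i))
  ·-combination c a p = begin-equality
    sum (λ j → c j * sum (λ i → a i * p i j))
      ≈⟨ sum-cong-≋ (λ j → *-distribˡ-sum (c j) (λ i → a i * p i j)) ⟩
    sum (λ j → sum (λ i → c j * (a i * p i j)))
      ≈⟨ ∑-comm (λ j i → c j * (a i * p i j)) ⟩
    sum (λ i → sum (λ j → c j * (a i * p i j)))
      ≈⟨ sum-cong-≋ (λ i → sum-cong-≋ (λ j → x∙yz≈y∙xz (c j) (a i) (p i j))) ⟩
    sum (λ i → sum (λ j → a i * (c j * p i j)))
      ≈⟨ sum-cong-≋ (λ i → *-distribˡ-sum (a i) (λ j → c j * p i j)) ⟨
    sum (λ i → a i * (c · p i)) ∎

  point∈affineSpan : ∀ {r m} (p : Fin r → Point m) i → p i ∈ affineSpan p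
  point∈affineSpan p i = δ i , sum-δ-one i , λ j → sym (sum-δ i (λ k → p k j))

  -- The new coefficients are the row vector `a` times the matrix `w` whose rows express the points
  -- of `q` through `p`.
  affineSpan-trans : ∀ {r s m} {q : Fin r → Point m} (p : Fin s → Point m) →
                     (∀ i → q i ∈ affineSpan p) → affineSpan q ⊆′ affineSpan p
  affineSpan-trans {q = q} p q∈p x (a , Σa≈1 , x≋aq) = b , Σb≈1 , x≋bp
    where
    w : ∀ i l → ℝ
    w i = proj₁ (q∈p i)

    b : ∀ l → ℝ
    b l = sum (λ i → a i * w i l)

    Σb≈1 : sum b ≈ 1#
    Σb≈1 = begin-equality
      sum (λ l → sum (λ i → a i * w i l)) ≈⟨ ∑-comm (λ i l → a i * w i l) ⟨
      sum (λ i → sum (λ l → a i * w i l)) ≈⟨ sum-cong-≋ (λ i → *-distribˡ-sum (a i) (w i)) ⟨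
      sum (λ i → a i * sum (w i))         ≈⟨ sum-cong-≋ (λ i → trans (*-congˡ (proj₁ (proj₂ (q∈p i)))) (*-identityʳ (a i))) ⟩
      sum a                               ≈⟨ Σa≈1 ⟩
      1#                                  ∎

    x≋bp : x ≋ combination b p
    x≋bp j = begin-equality
      x j
        ≈⟨ x≋aq j ⟩
      sum (λ i → a i * q i j)
        ≈⟨ sum-cong-≋ (λ i → *-congˡ (proj₂ (proj₂ (q∈p i)) j)) ⟩
      sum (λ i → a i * sum (λ l → w i l * p l j))
        ≈⟨ sum-cong-≋ (λ i → *-distribˡ-sum (a i) (λ l → w i l * p l j)) ⟩
      sum (λ i → sum (λ l → a i * (w i l * p l j)))
        ≈⟨ ∑-comm (λ i l → a i * (w i l * p l j)) ⟩
      sum (λ l → sum (λ i → a i * (w i l * p l j)))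
        ≈⟨ sum-cong-≋ (λ l → sum-cong-≋ (λ i → *-assoc (a i) (w i l) (p l j))) ⟨
      sum (λ l → sum (λ i → a i * w i l * p l j))
        ≈⟨ sum-cong-≋ (λ l → *-distribʳ-sum (p l j) (λ i → a i * w i l)) ⟨
      sum (λ l → b l * p l j) ∎

  ⊆-affineHull : ∀ {m} (S : Pred (Point m) 0ℓ) → S ⊆′ affineHull S
  ⊆-affineHull S x x∈S = 1 , (λ _ → x) , (λ _ → x∈S) , point∈affineSpan (λ _ → x) 0F

  -- Spans are closed under affine combinations, so it is enough to compare `S` itself with the span
  -- instead of its affine hull.
  hasDim : ∀ {d m} (S : Pred (Point m) 0ℓ) (p : Fin (suc d) → Point m) →
           AffinelyIndependent p → (∀ i → p i ∈ S) → S ⊆′ affineSpan p → HasDim S d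
  hasDim S p indep p∈S S⊆p = p , indep , (λ x x∈p → _ , p , p∈S , x∈p) ,
    λ x (_ , q , q∈S , x∈q) → affineSpan-trans p (λ i → S⊆p _ (q∈S i)) x x∈q

  point∈hull : ∀ {r m} (p : Fin r → Point m) i → p i ∈ convexHull p
  point∈hull p i = δ i , 0≤δ i , sum-δ-one i , λ j → sym (sum-δ i (λ k → p k j))

  -- Each point after the first is displaced from it along a single axis, so coordinate `j` of a
  -- combination involves only the total weight and the weight of `suc j`. The coordinates decouple,
  -- and dividing by `c j` gives both independence and the coefficients of an arbitrary point.
  axisSimplex-dim : ∀ {m} (S : Pred (Point m) 0ℓ) (q : Fin (suc m) → Point m) (c : Fin m → ℝ) →
                    (∀ i → ¬ c i ≈ 0#) → (∀ i j → q (suc i) j ≈ q zero j + δ j i * c i) →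
                    (∀ i → q i ∈ S) → HasDim S m
  axisSimplex-dim {m} S q c c≉0 q≈ q∈S = hasDim S q indep q∈S λ x _ → spans x
    where
    expand : ∀ (a : Fin (suc m) → ℝ) j → combination a q j ≈ sum a * q zero j + c j * a (suc j)
    expand a j = begin-equality
      a zero * q zero j + sum (λ i → a (suc i) * q (suc i) j)
        ≈⟨ +-congˡ (sum-cong-≋ (λ i → trans (*-congˡ (q≈ i j)) (distribˡ _ _ _))) ⟩
      a zero * q zero j + sum (λ i → a (suc i) * q zero j + a (suc i) * (δ j i * c i))
        ≈⟨ +-congˡ (∑-distrib-+ (λ i → a (suc i) * q zero j) (λ i → a (suc i) * (δ j i * c i))) ⟩
      a zero * q zero j + (sum (λ i → a (suc i) * q zero j) + sum (λ i → a (suc i) * (δ j i * c i)))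
        ≈⟨ +-assoc _ _ _ ⟨
      sum (λ i → a i * q zero j) + sum (λ i → a (suc i) * (δ j i * c i))
        ≈⟨ +-cong (*-distribʳ-sum (q zero j) a) (sum-cong-≋ (λ i → x∙yz≈y∙xz (δ j i) (a (suc i)) (c i))) ⟨
      sum a * q zero j + sum (λ i → δ j i * (a (suc i) * c i))
        ≈⟨ +-congˡ (trans (sum-δ j (λ i → a (suc i) * c i)) (*-comm (a (suc j)) (c j))) ⟩
      sum a * q zero j + c j * a (suc j) ∎

    tail≈0 : ∀ a → sum a ≈ 0# → combination a q ≋ (λ _ → 0#) → ∀ j → a (suc j) ≈ 0#
    tail≈0 a Σa≈0 aq≈0 j = *-cancelˡ (c≉0 j) (begin-equality
      c j * a (suc j)                    ≈⟨ +-identityˡ _ ⟨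
      0# + c j * a (suc j)               ≈⟨ +-congʳ (trans (*-congʳ Σa≈0) (zeroˡ (q zero j))) ⟨
      sum a * q zero j + c j * a (suc j) ≈⟨ expand a j ⟨
      combination a q j                  ≈⟨ aq≈0 j ⟩
      0#                                 ≈⟨ zeroʳ (c j) ⟨
      c j * 0#                           ∎)

    indep : AffinelyIndependent q
    indep a Σa≈0 aq≈0 (suc j) = tail≈0 a Σa≈0 aq≈0 j
    indep a Σa≈0 aq≈0 zero    = begin-equality
      a zero                         ≈⟨ +-identityʳ _ ⟨
      a zero + 0#                    ≈⟨ +-congˡ (sum-zero (tail≈0 a Σa≈0 aq≈0)) ⟨
      a zero + sum (λ i → a (suc i)) ≈⟨ Σa≈0 ⟩
      0#                             ∎

    spans : ∀ x → x ∈ affineSpan q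
    spans x = a , Σa≈1 , x≋aq
      where
      b : Fin m → ℝ
      b j = proj₁ (inverse (c j) (c≉0 j)) * (x j + - q zero j)

      a : Fin (suc m) → ℝ
      a zero    = 1# + - sum b
      a (suc j) = b j

      Σa≈1 : sum a ≈ 1#
      Σa≈1 = trans (+-assoc _ _ _) (trans (+-congˡ (-‿inverseˡ (sum b))) (+-identityʳ 1#))

      x≋aq : x ≋ combination a q
      x≋aq j = sym (begin-equality
        combination a q j                      ≈⟨ expand a j ⟩
        sum a * q zero j + c j * b j           ≈⟨ +-cong (trans (*-congʳ Σa≈1) (*-identityˡ _)) (sym (*-assoc _ _ _)) ⟩
        q zero j + _ * (x j + - q zero j)      ≈⟨ +-congˡ (trans (*-congʳ (proj₂ (inverse (c j) (c≉0 j)))) (*-identityˡ _)) ⟩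
        q zero j + (x j + - q zero j)          ≈⟨ +-assoc _ _ _ ⟨
        q zero j + x j + - q zero j            ≈⟨ xyx⁻¹≈y (q zero j) (x j) ⟩
        x j                                    ∎)

  -- Valid inequalities

  -- The finite counterpart of `Face`: validity is required at the generators only, and tightness is
  -- a decidable property of indices.
  record Inequality {r m} (p : Fin r → Point m) : Set where
    field
      normal : Point m
      bound  : ℝ
      valid  : ∀ i → normal · p i ≤ bound

    Tight : Pred (Fin r) 0ℓ
    Tight i = normal · p i ≈ bound

    Supports : Pred (Point m) 0ℓ
    Supports x = x ∈ convexHull p × normal · x ≈ bound

  module _ {r m} {p : Fin r → Point m} (I : Inequality p) where
    open Inequality I

    private
      constant : ∀ (a : Fin r → ℝ) → sum a ≈ 1# → sum (λ i → a i * bound) ≈ bound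
      constant a Σa≈1 = trans (sym (*-distribʳ-sum bound a)) (trans (*-congʳ Σa≈1) (*-identityˡ bound))

      value : ∀ {x a} → x ≋ combination a p → normal · x ≈ sum (λ i → a i * (normal · p i))
      value {a = a} x≋ap = trans (·-congʳ normal x≋ap) (·-combination normal a p)

    valid-hull : ∀ x → x ∈ convexHull p → normal · x ≤ bound
    valid-hull x (a , 0≤a , Σa≈1 , x≋ap) = begin
      normal · x                          ≈⟨ value x≋ap ⟩
      sum (λ i → a i * (normal · p i))    ≤⟨ sum-mono-≤ (λ i → *-monoˡ-≤ (0≤a i) (valid i)) ⟩
      sum (λ i → a i * bound)             ≈⟨ constant a Σa≈1 ⟩
      bound                               ∎

    -- Complementary slackness: the weighted values add up to the bound, so a generator with nonzero
    -- weight has no slack.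
    supports⇒tight : ∀ {x} ((a , _) : x ∈ convexHull p) → normal · x ≈ bound →
                     ∀ i → a i ≈ 0# ⊎ Tight i
    supports⇒tight (a , 0≤a , Σa≈1 , x≋ap) cx≈b i with a i ≟ 0#
    ... | yes a≈0 = inj₁ a≈0
    ... | no  a≉0 = inj₂ (*-cancelˡ a≉0 (sum-tight (λ i → *-monoˡ-≤ (0≤a i) (valid i))
            (trans (sym (value x≋ap)) (trans cx≈b (sym (constant a Σa≈1)))) i))

    tight⇒supports : ∀ {x} ((a , _) : x ∈ convexHull p) → (∀ i → a i ≈ 0# ⊎ Tight i) →
                     normal · x ≈ bound
    tight⇒supports (a , 0≤a , Σa≈1 , x≋ap) t = trans (value x≋ap)
      (trans (sum-cong-≋ (λ i → [ (λ a≈0 → trans (*-congʳ a≈0) (trans (zeroˡ _) (sym (trans (*-congʳ a≈0) (zeroˡ _)))))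
                               , *-congˡ ]′ (t i)))
             (constant a Σa≈1))

    tight-point : ∀ {i} → Tight i → p i ∈ Supports
    tight-point {i} tight = point∈hull p i , tight

    Supports⊆affineSpan : ∀ {d} (q : Fin (suc d) → Point m) →
                          (∀ i → Tight i → p i ∈ affineSpan q) → Supports ⊆′ affineSpan q
    Supports⊆affineSpan q tight∈q x (x∈P@(a , _ , Σa≈1 , x≋ap) , cx≈b) =
      affineSpan-trans q p′∈q x (a , Σa≈1 , λ j → trans (x≋ap j) (sum-cong-≋ (λ i → same i j)))
      where
      -- Generators of weight zero may lie outside the span. Replacing them by `q zero` leaves the
      -- combination unchanged and puts every generator in the span.
      p′ : Fin r → Point m
      p′ i = if does (a i ≟ 0#) then q zero else p i

      p′∈q : ∀ i → p′ i ∈ affineSpan q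
      p′∈q i with a i ≟ 0# | supports⇒tight x∈P cx≈b i
      ... | yes _   | _          = point∈affineSpan q zero
      ... | no  a≉0 | inj₁ a≈0   = contradiction a≈0 a≉0
      ... | no  _   | inj₂ tight = tight∈q i tight

      same : ∀ i j → a i * p i j ≈ a i * p′ i j
      same i j with a i ≟ 0#
      ... | yes a≈0 = trans (*-congʳ a≈0) (trans (zeroˡ _) (sym (trans (*-congʳ a≈0) (zeroˡ _))))
      ... | no  _   = refl

  -- The weights of a point of the first face sit on its tight indices, which are tight for the
  -- second inequality too.
  Supports-mono : ∀ {r m} {p : Fin r → Point m} (I J : Inequality p) →
                  (∀ i → Inequality.Tight I i → Inequality.Tight J i) →
                  Inequality.Supports I ⊆′ Inequality.Supports J
  Supports-mono I J I⊆J x (x∈P , cx≈b) = x∈P ,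
    tight⇒supports J x∈P (λ i → [ inj₁ , inj₂ ∘ I⊆J i ]′ (supports⇒tight I x∈P cx≈b i))

  -- Normal and bound are kept in both directions, so `region` and `Supports` agree definitionally.
  toInequality : ∀ {P} → Face P → Inequality (points P)
  toInequality {P} F = record
    { normal = Face.normal F
    ; bound  = Face.bound F
    ; valid  = λ i → Face.valid F (points P i) (point∈hull (points P) i)
    }

  toFace : ∀ {P} → Inequality (points P) → Face P
  toFace I = record
    { normal = Inequality.normal I
    ; bound  = Inequality.bound I
    ; valid  = valid-hull I
    }

  -- Polytopes with a prescribed graph

  -- Stated through tight sets, so that no dimension has to be computed to establish it. For
  -- reflexive `_~_`, `exposed` covers vertices as well as edges; `third` prevents the segment
  -- between two unrelated generators from being a face.
  record HasGraph {r m} (p : Fin r → Point m) (_~_ : Rel (Fin r) 0ℓ) : Set where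
    open Inequality
    field
      exposed : ∀ {i j} → i ~ j → Σ[ I ∈ Inequality p ]
                Tight I i × Tight I j × (∀ k → Tight I k → k ≡ i ⊎ k ≡ j)
      third   : ∀ {i j} → ¬ i ~ j → ∃[ k ] k ≢ i × k ≢ j ×
                (∀ (I : Inequality p) → Tight I i → Tight I j → Tight I k)

  module Graph {r m} {p : Fin r → Point m} {_~_ : Rel (Fin r) 0ℓ}
               (~-refl : ∀ {i} → i ~ i) (_~?_ : ∀ i j → Dec (i ~ j)) (graph : HasGraph p _~_) where
    open HasGraph graph
    open Inequality

    -- A vertex is the degenerate edge from `i` to itself.
    vertex : ∀ i → Σ[ I ∈ Inequality p ] Tight I i × (∀ k → k ≢ i → ¬ Tight I k)
    vertex i with exposed (~-refl {i})
    ... | I , tight , _ , only = I , tight , λ k k≢i → [ k≢i , k≢i ]′ ∘ only k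

    endpoints : Fin r → Fin r → Fin 2 → Point m
    endpoints i j 0F = p i
    endpoints i j 1F = p j

    -- The normal exposing vertex `i` takes different values at the two points. Applied to a
    -- vanishing combination whose weights cancel, it leaves `a 1F` times the difference of these
    -- values.
    endpoints-indep : ∀ {i j} → i ≢ j → AffinelyIndependent (endpoints i j)
    endpoints-indep {i} {j} i≢j a Σa≈0 comb≈0 = λ where
        0F → trans (sym (+-identityʳ _)) (trans (+-congˡ (sym a₁≈0)) a₀+a₁≈0)
        1F → a₁≈0
      where
      I = proj₁ (vertex i)
      y = normal I · p j

      a₀+a₁≈0 : a 0F + a 1F ≈ 0#
      a₀+a₁≈0 = trans (+-congˡ (sym (+-identityʳ _))) Σa≈0

      a₀b+a₁y≈0 : a 0F * bound I + a 1F * y ≈ 0#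
      a₀b+a₁y≈0 = begin-equality
        a 0F * bound I + a 1F * y
          ≈⟨ +-cong (*-congˡ (proj₁ (proj₂ (vertex i)))) (+-identityʳ _) ⟨
        sum (λ l → a l * (normal I · endpoints i j l))
          ≈⟨ ·-combination (normal I) a (endpoints i j) ⟨
        normal I · combination a (endpoints i j)
          ≈⟨ sum-zero (λ l → trans (*-congˡ (comb≈0 l)) (zeroʳ _)) ⟩
        0# ∎

      a₁≈0 : a 1F ≈ 0#
      a₁≈0 with a 1F ≟ 0#
      ... | yes a₁≈0 = a₁≈0
      ... | no  a₁≉0 = contradiction y≈b (proj₂ (proj₂ (vertex i)) j (i≢j ∘ ≡.sym))
        where
        y≈b : y ≈ bound I
        y≈b = *-cancelˡ a₁≉0 (+-cancelˡ (a 0F * bound I) _ _ (trans a₀b+a₁y≈0 (sym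
          (trans (sym (distribʳ _ _ _)) (trans (*-congʳ a₀+a₁≈0) (zeroˡ _))))))

    segment-dim : (I : Inequality p) → ∀ {i j} → Tight I i → Tight I j →
                  (∀ k → Tight I k → k ≡ i ⊎ k ≡ j) → DimAtMost (Supports I) 1
    segment-dim I {i} {j} ti tj only with i Fin.≟ j
    -- The degenerate edge is a single vertex, of dimension 0 instead of 1.
    ... | yes ≡.refl = inj₂ (0 , z≤n , hasDim _ q indep (λ _ → tight-point I ti)
            (Supports⊆affineSpan I q λ k tk → ≡.subst (λ k → p k ∈ affineSpan q)
              (≡.sym ([ (λ e → e) , (λ e → e) ]′ (only k tk))) (point∈affineSpan q 0F)))
      where
      q : Fin 1 → Point m
      q _ = p i

      indep : AffinelyIndependent q
      indep a Σa≈0 _ 0F = trans (sym (+-identityʳ _)) Σa≈0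
    ... | no i≢j = inj₂ (1 , ℕ.s≤s z≤n , hasDim _ q (endpoints-indep i≢j)
            (λ { 0F → tight-point I ti ; 1F → tight-point I tj })
            (Supports⊆affineSpan I q λ k tk → [ (λ { ≡.refl → point∈affineSpan q 0F })
                                             , (λ { ≡.refl → point∈affineSpan q 1F }) ]′ (only k tk)))
      where
      q = endpoints i j

    module Line (q : Fin 2 → Point m) where

      position : ∀ {i} → p i ∈ affineSpan q → ℝ
      position (w , _) = w 1F

      -- Along the line a linear functional is an affine function of `position`; the sign of its
      -- slope decides in which direction it grows.
      value : ∀ (c : Point m) {i} (i∈q : p i ∈ affineSpan q) →
              c · p i ≈ c · q 0F + position i∈q * (c · q 1F + - (c · q 0F))
      value c {i} (w , Σw≈1 , pi≋wq) = begin-equality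
        c · p i                               ≈⟨ trans (·-congʳ c pi≋wq) (·-combination c w q) ⟩
        w 0F * u + (w 1F * v + 0#)            ≈⟨ +-congˡ (+-identityʳ _) ⟩
        w 0F * u + w 1F * v                   ≈⟨ +-congˡ (*-congˡ (xyx⁻¹≈y u v)) ⟨
        w 0F * u + w 1F * (u + v + - u)       ≈⟨ +-congˡ (*-congˡ (+-assoc u v (- u))) ⟩
        w 0F * u + w 1F * (u + (v + - u))     ≈⟨ +-congˡ (distribˡ _ _ _) ⟩
        w 0F * u + (w 1F * u + w 1F * (v + - u)) ≈⟨ +-assoc _ _ _ ⟨
        w 0F * u + w 1F * u + w 1F * (v + - u) ≈⟨ +-congʳ (distribʳ u (w 0F) (w 1F)) ⟨
        (w 0F + w 1F) * u + w 1F * (v + - u)  ≈⟨ +-congʳ (*-congʳ (trans (+-congˡ (sym (+-identityʳ _))) Σw≈1)) ⟩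
        1# * u + w 1F * (v + - u)             ≈⟨ +-congʳ (*-identityˡ u) ⟩
        u + w 1F * (v + - u)                  ∎
        where
        u = c · q 0F
        v = c · q 1F

      -- The functional exposing vertex `j` is monotone along the line, so at `k` or at `i`,
      -- according to the sign of its slope, it is at least as large as at `j`, where it has its
      -- unique maximum among the generators.
      no-between : ∀ {i j k} (i∈q : p i ∈ affineSpan q) (j∈q : p j ∈ affineSpan q) (k∈q : p k ∈ affineSpan q) →
                   i ≢ j → k ≢ j → position i∈q ≤ position j∈q → ¬ position j∈q ≤ position k∈q
      no-between {i} {j} {k} i∈q j∈q k∈q i≢j k≢j xi≤xj xj≤xk with vertex j
      ... | I , tight-j , not-tight with total 0# (normal I · q 1F + - (normal I · q 0F))
      ...   | inj₁ 0≤D = not-tight k k≢j (≤-antisym (valid I k) (begin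
                bound I                      ≈⟨ tight-j ⟨
                normal I · p j               ≈⟨ value (normal I) j∈q ⟩
                _ + position j∈q * _         ≈⟨ +-congˡ (*-comm _ _) ⟩
                _ + _ * position j∈q         ≤⟨ +-monoʳ-≤ _ (*-monoˡ-≤ 0≤D xj≤xk) ⟩
                _ + _ * position k∈q         ≈⟨ +-congˡ (*-comm _ _) ⟨
                _ + position k∈q * _         ≈⟨ value (normal I) k∈q ⟨
                normal I · p k               ∎))
      ...   | inj₂ D≤0 = not-tight i i≢j (≤-antisym (valid I i) (begin
                bound I                      ≈⟨ tight-j ⟨
                normal I · p j               ≈⟨ value (normal I) j∈q ⟩
                _ + position j∈q * _         ≈⟨ +-congˡ (*-comm _ _) ⟩
                _ + _ * position j∈q         ≤⟨ +-monoʳ-≤ _ (*-antimonoˡ-≤ D≤0 xi≤xj) ⟩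
                _ + _ * position i∈q         ≈⟨ +-congˡ (*-comm _ _) ⟨
                _ + position i∈q * _         ≈⟨ value (normal I) i∈q ⟨
                normal I · p i               ∎))

      -- Of three positions on a line, one lies weakly between the other two.
      at-most-two : ∀ {i j k} → p i ∈ affineSpan q → p j ∈ affineSpan q → p k ∈ affineSpan q →
                    i ≢ j → j ≢ k → ¬ i ≢ k
      at-most-two i∈q j∈q k∈q i≢j j≢k i≢k
        with total (position i∈q) (position j∈q) | total (position j∈q) (position k∈q)
           | total (position i∈q) (position k∈q)
      ... | inj₁ i≤j | inj₁ j≤k | _        = no-between i∈q j∈q k∈q i≢j (j≢k ∘ ≡.sym) i≤j j≤k
      ... | inj₁ i≤j | inj₂ k≤j | inj₁ i≤k = no-between i∈q k∈q j∈q i≢k j≢k i≤k k≤j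
      ... | inj₁ i≤j | inj₂ k≤j | inj₂ k≤i = no-between k∈q i∈q j∈q (i≢k ∘ ≡.sym) (i≢j ∘ ≡.sym) k≤i i≤j
      ... | inj₂ j≤i | inj₁ j≤k | inj₁ i≤k = no-between j∈q i∈q k∈q (i≢j ∘ ≡.sym) (i≢k ∘ ≡.sym) j≤i i≤k
      ... | inj₂ j≤i | inj₁ j≤k | inj₂ k≤i = no-between j∈q k∈q i∈q j≢k i≢k j≤k k≤i
      ... | inj₂ j≤i | inj₂ k≤j | _        = no-between k∈q j∈q i∈q (j≢k ∘ ≡.sym) i≢j k≤j j≤i

    tight-on-line : (I : Inequality p) → DimAtMost (Supports I) 1 → ∃[ i ] Tight I i →
                    Σ[ q ∈ (Fin 2 → Point m) ] (∀ i → Tight I i → p i ∈ affineSpan q)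
    tight-on-line I (inj₁ empty) (i , ti) = contradiction (tight-point I ti) (empty (p i))
    -- A zero-dimensional face is put on a line with coinciding base points, so that both dimensions
    -- go through `Line`.
    tight-on-line I (inj₂ (0 , _ , q , _ , _ , hull⊆q)) _ = q₀ , λ i ti →
      affineSpan-trans {q = q} q₀ (λ { 0F → point∈affineSpan q₀ 0F }) (p i)
        (hull⊆q (p i) (⊆-affineHull (Supports I) (p i) (tight-point I ti)))
      where
      q₀ : Fin 2 → Point m
      q₀ _ = q 0F
    tight-on-line I (inj₂ (1 , _ , q , _ , _ , hull⊆q)) _ = q , λ i ti →
      hull⊆q (p i) (⊆-affineHull (Supports I) (p i) (tight-point I ti))
    tight-on-line I (inj₂ (suc (suc _) , s≤s () , _)) _

    -- The tight generators lie on a line, which has room for at most two vertices. If there are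
    -- two, they are related, since otherwise `third` would add another tight generator.
    classify : (I : Inequality p) → DimAtMost (Supports I) 1 →
               (∀ k → ¬ Tight I k) ⊎
               ∃[ i ] ∃[ j ] i ~ j × Tight I i × Tight I j × (∀ k → Tight I k → k ≡ i ⊎ k ≡ j)
    classify I dim with Fin.any? (λ k → normal I · p k ≟ bound I)
    ... | no none = inj₁ λ k tk → none (k , tk)
    ... | yes (i , ti) = inj₂ (pair (Fin.any? (λ k → tight? k ×-dec ¬? (k Fin.≟ i))))
      where
      tight? : ∀ k → Dec (Tight I k)
      tight? k = normal I · p k ≟ bound I

      q = proj₁ (tight-on-line I dim (i , ti))

      no-three : ∀ {j k} → Tight I j → Tight I k → j ≢ i → k ≢ i → ¬ k ≢ j
      no-three tj tk j≢i k≢i k≢j = Line.at-most-two q (on-q ti) (on-q tj) (on-q tk)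
        (j≢i ∘ ≡.sym) (k≢j ∘ ≡.sym) (k≢i ∘ ≡.sym)
        where
        on-q : ∀ {l} → Tight I l → p l ∈ affineSpan q
        on-q {l} = proj₂ (tight-on-line I dim (i , ti)) l

      pair : Dec (∃[ k ] Tight I k × k ≢ i) →
             ∃[ i ] ∃[ j ] i ~ j × Tight I i × Tight I j × (∀ k → Tight I k → k ≡ i ⊎ k ≡ j)
      pair (no unique) = i , i , ~-refl , ti , ti , λ k tk →
        inj₁ (decidable-stable (k Fin.≟ i) λ k≢i → unique (k , tk , k≢i))
      pair (yes (j , tj , j≢i)) = i , j , i~j , ti , tj , only
        where
        i~j : i ~ j
        i~j = decidable-stable (i ~? j) λ i≁j →
          let k , k≢i , k≢j , tight-k = third i≁j in no-three tj (tight-k I ti tj) j≢i k≢i k≢j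

        only : ∀ k → Tight I k → k ≡ i ⊎ k ≡ j
        only k tk with k Fin.≟ i
        ... | yes k≡i = inj₁ k≡i
        ... | no  k≢i = inj₂ (decidable-stable (k Fin.≟ j) (no-three tj tk j≢i k≢i))

  -- Polytopes with the same graph have isomorphic 1-skeleta.

  empty : ∀ {r m} (p : Fin r → Point m) → Inequality p
  empty p = record
    { normal = λ _ → 0#
    ; bound  = 1#
    ; valid  = λ i → ≤-trans (≤-reflexive (sum-zero (λ j → zeroˡ (p i j)))) 0≤1
    }

  empty-tight : ∀ {r m} (p : Fin r → Point m) i → ¬ Inequality.Tight (empty p) i
  empty-tight p i 0≈1 = 0≉1 (trans (sym (sum-zero (λ j → zeroˡ (p i j)))) 0≈1)

  empty-dim : ∀ {r m} (p : Fin r → Point m) k → DimAtMost (Inequality.Supports (empty p)) k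
  empty-dim p k = inj₁ λ x (_ , 0≈1) → 0≉1 (trans (sym (sum-zero (λ j → zeroˡ (x j)))) 0≈1)

  module SameGraph {r} {_~_ : Rel (Fin r) 0ℓ} (~-refl : ∀ {i} → i ~ i) (_~?_ : ∀ i j → Dec (i ~ j)) where
    open Inequality

    -- By the classification, the tight set is empty or consists of the ends of a possibly
    -- degenerate edge, and `p′` realizes each of these sets.
    transfer : ∀ {m m′} {p : Fin r → Point m} {p′ : Fin r → Point m′} →
               HasGraph p _~_ → HasGraph p′ _~_ →
               (I : Inequality p) → DimAtMost (Supports I) 1 →
               Σ[ J ∈ Inequality p′ ] DimAtMost (Supports J) 1 ×
                 (∀ k → Tight I k → Tight J k) × (∀ k → Tight J k → Tight I k)
    transfer {p′ = p′} g g′ I dim with Graph.classify ~-refl _~?_ g I dim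
    ... | inj₁ none = empty p′ , empty-dim p′ 1 ,
            (λ k tk → contradiction tk (none k)) , (λ k tk → contradiction tk (empty-tight p′ k))
    ... | inj₂ (i , j , i~j , ti , tj , only) with HasGraph.exposed g′ i~j
    ...   | J , ti′ , tj′ , only′ = J , Graph.segment-dim ~-refl _~?_ g′ J ti′ tj′ only′ ,
            (λ k tk → [ (λ { ≡.refl → ti′ }) , (λ { ≡.refl → tj′ }) ]′ (only k tk)) ,
            (λ k tk → [ (λ { ≡.refl → ti }) , (λ { ≡.refl → tj }) ]′ (only′ k tk))

    skeleton-≅ : ∀ {m m′} {p : Fin r → Point m} {p′ : Fin r → Point m′} →
                 HasGraph p _~_ → HasGraph p′ _~_ →
                 skeleton 1 (record { points = p }) ≅ skeleton 1 (record { points = p′ })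
    skeleton-≅ {p = p} {p′} g g′ = f , record
      { isOrderMonomorphism = record
        { isOrderHomomorphism = record
          { cong = λ {F} {G} (F⊆G , G⊆F) → mono {F} {G} F⊆G , mono {G} {F} G⊆F
          ; mono = λ {F} {G} → mono {F} {G}
          }
        ; injective = λ {F} {G} (F⊆G , G⊆F) → cancel {F} {G} F⊆G , cancel {G} {F} G⊆F
        ; cancel    = λ {F} {G} → cancel {F} {G}
        }
      ; surjective = λ (G , dim) →
          let J = toInequality G
              I , dimI , J⊆I , I⊆J = transfer g′ g J dim
              F₀ = toFace I , dimI
              -- The round trip need not return the inequality `J`, only one with the same tight
              -- set; this suffices because faces are compared as point sets.
              H , _ , I⊆H , H⊆I = transfer g g′ (toInequality (proj₁ F₀)) dimI
          in F₀ , λ {F} (F⊆I , I⊆F) →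
            (λ x → Supports-mono H J (λ k → I⊆J k ∘ H⊆I k) x ∘ mono {F} {F₀} F⊆I x) ,
            (λ x → mono {F₀} {F} I⊆F x ∘ Supports-mono J H (λ k → I⊆H k ∘ J⊆I k) x)
      }
      where
      P  = record { points = p }
      P′ = record { points = p′ }

      SmallFace : Polytope → Set
      SmallFace Q = Σ[ F ∈ Face Q ] DimAtMost (region F) 1

      f : SmallFace P → SmallFace P′
      f (F , dim) = let J , dimJ , _ = transfer g g′ (toInequality F) dim in toFace J , dimJ

      tight : ∀ {Q} → SmallFace Q → Pred (Fin (size Q)) 0ℓ
      tight (F , _) = Tight (toInequality F)

      tight-⊆ : ∀ {Q} (F G : SmallFace Q) → region (proj₁ F) ⊆′ region (proj₁ G) →
                ∀ k → tight F k → tight G k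
      tight-⊆ {Q} (F , _) _ F⊆G k tk = proj₂ (F⊆G (points Q k) (tight-point (toInequality F) tk))

      mono : ∀ {F G} → region (proj₁ F) ⊆′ region (proj₁ G) →
             region (proj₁ (f F)) ⊆′ region (proj₁ (f G))
      mono {F} {G} F⊆G =
        let I , _ , _ , I⊆F = transfer g g′ (toInequality (proj₁ F)) (proj₂ F)
            J , _ , G⊆J , _ = transfer g g′ (toInequality (proj₁ G)) (proj₂ G)
        in Supports-mono I J (λ k → G⊆J k ∘ tight-⊆ F G F⊆G k ∘ I⊆F k)

      cancel : ∀ {F G} → region (proj₁ (f F)) ⊆′ region (proj₁ (f G)) →
               region (proj₁ F) ⊆′ region (proj₁ G)
      cancel {F} {G} fF⊆fG =
        let I , _ , F⊆I , _ = transfer g g′ (toInequality (proj₁ F)) (proj₂ F)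
            J , _ , _ , J⊆G = transfer g g′ (toInequality (proj₁ G)) (proj₂ G)
        in Supports-mono (toInequality (proj₁ F)) (toInequality (proj₁ G))
             (λ k → J⊆G k ∘ tight-⊆ (f F) (f G) fF⊆fG k ∘ F⊆I k)

-- The graph of the cube, on bit strings

funToFin-cong : ∀ {m n} {f g : Fin n → Fin m} → f ≗ g → funToFin f ≡ funToFin g
funToFin-cong {n = zero}  f≗g = ≡.refl
funToFin-cong {n = suc n} f≗g = ≡.cong₂ combine (f≗g zero) (funToFin-cong (f≗g ∘ suc))

only-two-bits : ∀ {a b c : Fin 2} → a ≢ b → c ≢ a → c ≡ b
only-two-bits {0F} {0F} a≢b c≢a = contradiction ≡.refl a≢b
only-two-bits {1F} {1F} a≢b c≢a = contradiction ≡.refl a≢b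
only-two-bits {0F} {1F} {0F} a≢b c≢a = contradiction ≡.refl c≢a
only-two-bits {0F} {1F} {1F} a≢b c≢a = ≡.refl
only-two-bits {1F} {0F} {0F} a≢b c≢a = ≡.refl
only-two-bits {1F} {0F} {1F} a≢b c≢a = contradiction ≡.refl c≢a

module BitStrings (n : ℕ) where

  bits : Fin (2 ^ suc n) → Fin (suc n) → Fin 2
  bits = finToFun {2} {suc n}

  bits-injective : ∀ {S T} → bits S ≗ bits T → S ≡ T
  bits-injective {S} {T} eq = ≡.trans (≡.sym (Fin.funToFin-finToFin {suc n} {2} S))
    (≡.trans (funToFin-cong eq) (Fin.funToFin-finToFin {suc n} {2} T))

  -- Adjacency or equality: the bit `k` is allowed to agree as well.
  _~_ : Rel (Fin (2 ^ suc n)) 0ℓ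
  S ~ T = ∃[ k ] (∀ j → j ≢ k → bits S j ≡ bits T j)

  ~-refl : ∀ {S} → S ~ S
  ~-refl = zero , λ _ _ → ≡.refl

  _~?_ : ∀ S T → Dec (S ~ T)
  S ~? T = Fin.any? λ k → Fin.all? λ j → ¬? (j Fin.≟ k) →-dec (bits S j Fin.≟ bits T j)

  -- All bits of `U` other than `k` are fixed by the common bits, and bit `k` has two values. So an
  -- edge is cut out once each common bit is forced.
  ~-interval : ∀ {S T} U → S ~ T → (∀ j → bits S j ≡ bits T j → bits U j ≡ bits S j) →
               U ≡ S ⊎ U ≡ T
  ~-interval {S} {T} U (k , near) common with bits U k Fin.≟ bits S k
  ... | yes eq = inj₁ (bits-injective agree)
    where
    agree : bits U ≗ bits S
    agree j with j Fin.≟ k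
    ... | yes ≡.refl = eq
    ... | no  j≢k    = common j (near j j≢k)
  ... | no neq = inj₂ (bits-injective agree)
    where
    agree : bits U ≗ bits T
    agree j with j Fin.≟ k
    ... | yes ≡.refl = only-two-bits (λ eq → neq (common k eq)) neq
    ... | no  j≢k    = ≡.trans (common j (near j j≢k)) (near j j≢k)

  replace : Fin (2 ^ suc n) → Fin (suc n) → Fin 2 → Fin (2 ^ suc n)
  replace S j e = funToFin (updateAt (bits S) j (λ _ → e))

  bits-replace : ∀ S j e → bits (replace S j e) j ≡ e
  bits-replace S j e = ≡.trans (Fin.finToFun-funToFin {suc n} (updateAt (bits S) j (λ _ → e)) j)
    (updateAt-updates j (bits S))

  bits-replace-≢ : ∀ S j e {k} → k ≢ j → bits (replace S j e) k ≡ bits S k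
  bits-replace-≢ S j e {k} k≢j = ≡.trans
    (Fin.finToFun-funToFin {suc n} (updateAt (bits S) j (λ _ → e)) k)
    (updateAt-minimal k j (bits S) k≢j)

  -- Strings that differ at most in bit 0 are related. A differing bit other than 0 is wanted
  -- because exchanging it leaves the scales, which bit 0 controls, unchanged.
  ≁-differ : ∀ {S T} → ¬ S ~ T → ∃[ j ] bits S (suc j) ≢ bits T (suc j)
  ≁-differ {S} {T} S≁T with Fin.any? (λ j → ¬? (bits S (suc j) Fin.≟ bits T (suc j)))
  ... | yes differ = differ
  ... | no  none   = contradiction (zero , agree) S≁T
    where
    agree : ∀ j → j ≢ zero → bits S j ≡ bits T j
    agree zero    0≢0 = contradiction ≡.refl 0≢0
    agree (suc j) _   = decidable-stable (_ Fin.≟ _) λ neq → none (j , neq)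

-- Polytopes generated by scaled bit strings, and the cube.

module CubeGraph (𝓡 : RealField) (n : ℕ) where

  open RealField 𝓡 hiding (zero) renaming (Carrier to ℝ)
  open OrderedField 𝓡
  open Polytopes 𝓡 hiding (normal; bound; valid)
  open Skeleta 𝓡
  open Inequality
  open BitStrings n
  open ≤-Reasoning

  module _ {m r} {p : Fin r → Point m} where

    ∑-· : ∀ {s} (c : Fin s → Point m) (x : Point m) →
          (λ l → sum (λ k → c k l)) · x ≈ sum (λ k → c k · x)
    ∑-· c x = trans (sum-cong-≋ (λ l → *-distribʳ-sum (x l) (λ k → c k l))) (∑-comm (λ l k → c k l * x l))

    -- The sum of valid inequalities exposes the intersection of their faces.
    conjunction : ∀ {s} → (Fin s → Inequality p) → Inequality p
    conjunction I = record
      { normal = λ l → sum (λ k → normal (I k) l)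
      ; bound  = sum (λ k → bound (I k))
      ; valid  = λ i → ≤-trans (≤-reflexive (∑-· (λ k → normal (I k)) (p i))) (sum-mono-≤ (λ k → valid (I k) i))
      }

    conjunction-tight : ∀ {s} (I : Fin s → Inequality p) {i} → (∀ k → Tight (I k) i) → Tight (conjunction I) i
    conjunction-tight I tight = trans (∑-· (λ k → normal (I k)) (p _)) (sum-cong-≋ tight)

    conjunction-tight⁻ : ∀ {s} (I : Fin s → Inequality p) {i} → Tight (conjunction I) i → ∀ k → Tight (I k) i
    conjunction-tight⁻ I {i} tight = sum-tight (λ k → valid (I k) i)
      (trans (sym (∑-· (λ k → normal (I k)) (p i))) tight)

    -- Stands in the conjunction for a bit in which the ends of an edge differ.
    trivial : Inequality p
    trivial = record
      { normal = λ _ → 0#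
      ; bound  = 0#
      ; valid  = λ i → ≤-reflexive (sum-zero (λ l → zeroˡ (p i l)))
      }

  -- Both sides have total weight `α + β`, and the left one attains the correspondingly scaled
  -- bound. Hence so does the right one, and neither of its terms of nonzero weight can have slack.
  exchange : ∀ {m} {p : Fin (2 ^ suc n) → Point m} (I : Inequality p) {S T S′ T′ α β} →
             0# ≤ α → ¬ α ≈ 0# → 0# ≤ β →
             (∀ l → α * p S l + β * p T l ≈ α * p S′ l + β * p T′ l) →
             Tight I S → Tight I T → Tight I S′
  exchange {p = p} I {S} {T} {S′} {T′} {α} {β} 0≤α α≉0 0≤β eq tS tT =
    *-cancelˡ α≉0 (+-tightˡ (*-monoˡ-≤ 0≤α (valid I S′)) (*-monoˡ-≤ 0≤β (valid I T′)) (begin-equality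
      α * (normal I · p S′) + β * (normal I · p T′) ≈⟨ pair S′ T′ ⟨
      normal I · combination weights (ends S′ T′)   ≈⟨ ·-congʳ (normal I) (λ l →
        trans (+-congˡ (+-identityʳ _)) (trans (sym (eq l)) (+-congˡ (sym (+-identityʳ _))))) ⟩
      normal I · combination weights (ends S T)     ≈⟨ pair S T ⟩
      α * (normal I · p S) + β * (normal I · p T)   ≈⟨ +-cong (*-congˡ tS) (*-congˡ tT) ⟩
      α * bound I + β * bound I                     ∎))
    where
    weights : Fin 2 → ℝ
    weights 0F = α
    weights 1F = β

    ends : Fin (2 ^ suc n) → Fin (2 ^ suc n) → Fin 2 → Point _
    ends S T 0F = p S
    ends S T 1F = p T

    pair : ∀ S T → normal I · combination weights (ends S T) ≈ α * (normal I · p S) + β * (normal I · p T)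
    pair S T = trans (·-combination (normal I) weights (ends S T)) (+-congˡ (+-identityʳ _))

  ForcesBit : ∀ {m} (p : Fin (2 ^ suc n) → Point m) → Fin (2 ^ suc n) → Fin (2 ^ suc n) → Fin (suc n) → Set
  ForcesBit p S T k = Σ[ I ∈ Inequality p ]
    Tight I S × Tight I T × (∀ U → Tight I U → bits U k ≡ bits S k)

  -- Coordinate l depends on bit b l only, up to a positive scale depending on bit 0.
  -- If S and T differ in a bit j ≠ 0, exchanging this bit between them gives
  -- points S′ and T′ with s_j(T) S + s_j(S) T = s_j(T) S′ + s_j(S) T′, so a
  -- face containing S and T contains S′.
  hasGraph : ∀ {m} {p : Fin (2 ^ suc n) → Point m} (b : Fin m → Fin (suc n))
             (s : Fin (suc n) → Fin 2 → ℝ) (κ : Fin 2 → ℝ) →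
             (∀ j e → 0# ≤ s j e) → (∀ j e → ¬ s j e ≈ 0#) →
             (∀ S l → p S l ≈ s (b l) (bits S 0F) * κ (bits S (b l))) →
             (∀ {S T} → S ~ T → ∀ k → bits S k ≡ bits T k → ForcesBit p S T k) →
             HasGraph p _~_
  hasGraph {m} {p} b s κ 0≤s s≉0 p≈ forces = record { exposed = exposed ; third = third }
    where
    exposed : ∀ {S T} → S ~ T → Σ[ I ∈ Inequality p ]
              Tight I S × Tight I T × (∀ U → Tight I U → U ≡ S ⊎ U ≡ T)
    exposed {S} {T} S~T = conjunction I , conjunction-tight I (proj₁ ∘ tight) , conjunction-tight I (proj₂ ∘ tight) ,
        λ U tU → ~-interval U S~T λ k → forced U k (conjunction-tight⁻ I tU k)
      where
      I : Fin (suc n) → Inequality p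
      I k with bits S k Fin.≟ bits T k
      ... | yes eq = proj₁ (forces S~T k eq)
      ... | no  _  = trivial

      tight : ∀ k → Tight (I k) S × Tight (I k) T
      tight k with bits S k Fin.≟ bits T k
      ... | yes eq = proj₁ (proj₂ (forces S~T k eq)) , proj₁ (proj₂ (proj₂ (forces S~T k eq)))
      ... | no  _  = sum-zero (λ l → zeroˡ (p S l)) , sum-zero (λ l → zeroˡ (p T l))

      forced : ∀ U k → Tight (I k) U → bits S k ≡ bits T k → bits U k ≡ bits S k
      forced U k tU eq with bits S k Fin.≟ bits T k
      ... | yes eq = proj₂ (proj₂ (proj₂ (forces S~T k eq))) U tU
      ... | no neq = contradiction eq neq

    third : ∀ {S T} → ¬ S ~ T → ∃[ U ] U ≢ S × U ≢ T ×
            (∀ (I : Inequality p) → Tight I S → Tight I T → Tight I U)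
    third {S} {T} S≁T = S′ , S′≢S , S′≢T ,
        λ I → exchange I (0≤s j (bits T 0F)) (s≉0 j (bits T 0F)) (0≤s j (bits S 0F)) balanced
      where
      j = suc (proj₁ (≁-differ {S} {T} S≁T))
      S′ = replace S j (bits T j)
      T′ = replace T j (bits S j)

      S′≢S : S′ ≢ S
      S′≢S eq = proj₂ (≁-differ {S} {T} S≁T)
        (≡.trans (≡.cong (λ U → bits U j) (≡.sym eq)) (bits-replace S j (bits T j)))

      S′≢T : S′ ≢ T
      -- If the exchange at `j` turned `S` into `T`, the two would differ at most in `j` and be
      -- related.
      S′≢T eq = S≁T (j , λ k k≢j →
        ≡.trans (≡.sym (bits-replace-≢ S j (bits T j) k≢j)) (≡.cong (λ U → bits U k) eq))

      0≢j : 0F ≢ j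
      0≢j ()

      p-replace : ∀ S e l → b l ≢ j → p (replace S j e) l ≈ p S l
      p-replace S e l bl≢j = trans (p≈ (replace S j e) l) (trans (reflexive
        (≡.cong₂ (λ x y → s (b l) x * κ y) (bits-replace-≢ S j e 0≢j) (bits-replace-≢ S j e bl≢j))) (sym (p≈ S l)))

      p-replaced : ∀ S e l → b l ≡ j → p (replace S j e) l ≈ s j (bits S 0F) * κ e
      p-replaced S e l bl≡j = trans (p≈ (replace S j e) l) (reflexive
        (≡.trans (≡.cong (λ k → s k (bits (replace S j e) 0F) * κ (bits (replace S j e) k)) bl≡j)
          (≡.cong₂ (λ x y → s j x * κ y) (bits-replace-≢ S j e 0≢j) (bits-replace S j e))))

      p-at : ∀ S l → b l ≡ j → p S l ≈ s j (bits S 0F) * κ (bits S j)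
      p-at S l bl≡j = trans (p≈ S l) (reflexive (≡.cong (λ k → s k (bits S 0F) * κ (bits S k)) bl≡j))

      α = s j (bits T 0F)
      β = s j (bits S 0F)

      balanced : ∀ l → α * p S l + β * p T l ≈ α * p S′ l + β * p T′ l
      balanced l with b l Fin.≟ j
      ... | no  bl≢j = sym (+-cong (*-congˡ (p-replace S _ l bl≢j)) (*-congˡ (p-replace T _ l bl≢j)))
      ... | yes bl≡j = begin-equality
        α * p S l + β * p T l
          ≈⟨ +-cong (*-congˡ (p-at S l bl≡j)) (*-congˡ (p-at T l bl≡j)) ⟩
        α * (β * κ (bits S j)) + β * (α * κ (bits T j))
          ≈⟨ +-cong (x∙yz≈y∙xz _ _ _) (x∙yz≈y∙xz _ _ _) ⟩
        β * (α * κ (bits S j)) + α * (β * κ (bits T j))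
          ≈⟨ +-comm _ _ ⟩
        α * (β * κ (bits T j)) + β * (α * κ (bits S j))
          ≈⟨ +-cong (*-congˡ (p-replaced S _ l bl≡j)) (*-congˡ (p-replaced T _ l bl≡j)) ⟨
        α * p S′ l + β * p T′ l ∎

  origin : Fin (2 ^ suc n)
  origin = funToFin {suc n} (λ _ → 0F)

  bits-origin : ∀ k → bits origin k ≡ 0F
  bits-origin = Fin.finToFun-funToFin {suc n} (λ _ → 0F)

  -- The simplex consists of the zero string and the strings with the single bit `b i` set. Setting
  -- this bit leaves the scales at their values for bit 0 equal to 0, so it moves the point along
  -- axis `i` only.
  fullDim : ∀ {m} (p : Fin (2 ^ suc n) → Point m) (b : Fin m → Fin (suc n))
            (s : Fin (suc n) → Fin 2 → ℝ) (κ : Fin 2 → ℝ) (d : ℝ) →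
            (∀ j e → ¬ s j e ≈ 0#) → κ 1F ≈ κ 0F + d → ¬ d ≈ 0# →
            (∀ {i j} → b i ≡ b j → i ≡ j) →
            (∀ i j → s j (bits (replace origin (b i) 1F) 0F) ≈ s j 0F) →
            (∀ S l → p S l ≈ s (b l) (bits S 0F) * κ (bits S (b l))) →
            HasDim (convexHull p) m
  fullDim {m} p b s κ d s≉0 κ1≈κ0+d d≉0 b-injective s≈ p≈ =
      axisSimplex-dim (convexHull p) (p ∘ q) c c≉0 displaced (point∈hull p ∘ q)
    where
    q : Fin (suc m) → Fin (2 ^ suc n)
    q zero    = origin
    q (suc i) = replace origin (b i) 1F

    c : Fin m → ℝ
    c i = s (b i) 0F * d

    c≉0 : ∀ i → ¬ c i ≈ 0#
    c≉0 i sd≈0 = d≉0 (*-cancelˡ (s≉0 (b i) 0F) (trans sd≈0 (sym (zeroʳ _))))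

    p-origin : ∀ l → p origin l ≈ s (b l) 0F * κ 0F
    p-origin l = trans (p≈ origin l)
      (reflexive (≡.cong₂ (λ x y → s (b l) x * κ y) (bits-origin 0F) (bits-origin (b l))))

    p-axis : ∀ i l → p (q (suc i)) l ≈ s (b l) 0F * κ (bits (q (suc i)) (b l))
    p-axis i l = trans (p≈ (q (suc i)) l) (*-congʳ (s≈ i (b l)))

    displaced : ∀ i j → p (q (suc i)) j ≈ p origin j + δ j i * c i
    displaced i j with j Fin.≟ i
    ... | yes ≡.refl = begin-equality
      p (q (suc i)) i                        ≈⟨ p-axis i i ⟩
      s (b i) 0F * κ (bits (q (suc i)) (b i)) ≈⟨ *-congˡ (reflexive (≡.cong κ (bits-replace origin (b i) 1F))) ⟩
      s (b i) 0F * κ 1F                      ≈⟨ *-congˡ κ1≈κ0+d ⟩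
      s (b i) 0F * (κ 0F + d)                ≈⟨ distribˡ _ _ _ ⟩
      s (b i) 0F * κ 0F + c i                ≈⟨ +-cong (p-origin i) (trans (*-congʳ (δ-refl i)) (*-identityˡ _)) ⟨
      p origin i + δ i i * c i               ∎
    ... | no j≢i = begin-equality
      p (q (suc i)) j                        ≈⟨ p-axis i j ⟩
      s (b j) 0F * κ (bits (q (suc i)) (b j)) ≈⟨ *-congˡ (reflexive (≡.cong κ (≡.trans
        (bits-replace-≢ origin (b i) 1F (j≢i ∘ b-injective)) (bits-origin (b j))))) ⟩
      s (b j) 0F * κ 0F                      ≈⟨ p-origin j ⟨
      p origin j                             ≈⟨ +-identityʳ _ ⟨
      p origin j + 0#                        ≈⟨ +-congˡ (trans (*-congʳ (δ-≢ j≢i)) (zeroˡ _)) ⟨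
      p origin j + δ j i * c i               ∎

  axis : ∀ {m} → ℝ → Fin m → Point m
  axis c l j = δ l j * c

  axis-· : ∀ {m} c (l : Fin m) x → axis c l · x ≈ c * x l
  axis-· c l x = trans (sum-cong-≋ (λ j → *-assoc (δ l j) c (x j))) (sum-δ l (λ j → c * x j))

  coordinate : Fin 2 → ℝ
  coordinate 0F = 0#
  coordinate 1F = 1#

  cube-point : ∀ S l → points (cube (suc n)) S l ≈ coordinate (bits S l)
  cube-point S l with bits S l
  ... | 0F = refl
  ... | 1F = refl

  cube-point′ : ∀ S l → points (cube (suc n)) S l ≈ 1# * coordinate (bits S l)
  cube-point′ S l = trans (cube-point S l) (sym (*-identityˡ _))

  cube-dim : HasDim ⟦ cube (suc n) ⟧ (suc n)
  cube-dim = fullDim (points (cube (suc n))) (λ l → l) (λ _ _ → 1#) coordinate 1#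
    (λ _ _ → 1≉0) (sym (+-identityˡ 1#)) 1≉0 (λ eq → eq) (λ _ _ → refl) cube-point′

  -- With constant scale 1, the facet of the cube given by the value of bit `k`, lying in `x_k = 0`
  -- or `x_k = 1`, forces that bit.
  cube-graph : HasGraph (points (cube (suc n))) _~_
  cube-graph = hasGraph (λ l → l) (λ _ _ → 1#) coordinate (λ _ _ → 0≤1) (λ _ _ → 1≉0) cube-point′
      λ _ k → forces k
    where
    sign : Fin 2 → ℝ
    sign 0F = - 1#
    sign 1F = 1#

    sign-coordinate : ∀ β → sign β * coordinate β ≈ coordinate β
    sign-coordinate 0F = zeroʳ _
    sign-coordinate 1F = *-identityˡ _

    sign-coordinate-≤ : ∀ β η → sign β * coordinate η ≤ coordinate β
    sign-coordinate-≤ 0F 0F = ≤-reflexive (zeroʳ _)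
    sign-coordinate-≤ 0F 1F = ≤-trans (≤-reflexive (*-identityʳ _)) (≤-trans (neg-mono-≤ 0≤1) (≤-reflexive -0#≈0#))
    sign-coordinate-≤ 1F 0F = ≤-trans (≤-reflexive (zeroʳ _)) 0≤1
    sign-coordinate-≤ 1F 1F = ≤-reflexive (*-identityˡ _)

    sign-coordinate-tight : ∀ β η → sign β * coordinate η ≈ coordinate β → η ≡ β
    sign-coordinate-tight 0F 0F _  = ≡.refl
    sign-coordinate-tight 1F 1F _  = ≡.refl
    sign-coordinate-tight 1F 0F eq = contradiction (trans (sym (zeroʳ _)) eq) 0≉1
    sign-coordinate-tight 0F 1F eq = contradiction
      (trans (sym (-‿involutive 1#)) (trans (-‿cong (trans (sym (*-identityʳ _)) eq)) -0#≈0#)) 1≉0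

    forces : ∀ {S T} k → bits S k ≡ bits T k → ForcesBit (points (cube (suc n))) S T k
    forces {S} {T} k eq = I , tight S ≡.refl , tight T (≡.sym eq) ,
        λ U tU → sign-coordinate-tight β (bits U k) (trans (sym (value U)) tU)
      where
      β = bits S k

      value : ∀ U → axis (sign β) k · points (cube (suc n)) U ≈ sign β * coordinate (bits U k)
      value U = trans (axis-· _ k (points (cube (suc n)) U)) (*-congˡ (cube-point U k))

      I : Inequality (points (cube (suc n)))
      I = record
        { normal = axis (sign β) k
        ; bound  = coordinate β
        ; valid  = λ U → ≤-trans (≤-reflexive (value U)) (sign-coordinate-≤ β (bits U k))
        }

      tight : ∀ U → bits U k ≡ β → Tight I U
      tight U eq = trans (value U) (trans (*-congˡ (reflexive (≡.cong coordinate eq))) (sign-coordinate β))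

-- The polytope of one dimension less.

module Twisted (𝓡 : RealField) (r : ℕ) where

  open RealField 𝓡 hiding (zero) renaming (Carrier to ℝ)
  open OrderedField 𝓡
  open Polytopes 𝓡 hiding (normal; bound; valid)
  open Skeleta 𝓡
  open Inequality
  open BitStrings (4 ℕ.+ r)
  open CubeGraph 𝓡 (4 ℕ.+ r)
  open ≤-Reasoning

  -- The arguments are the group of the coordinate and the value of t. The scale 2 occurs exactly
  -- when they differ, whence the uses of `opposite`.
  size₂ : Fin 2 → Fin 2 → ℝ
  size₂ 0F 0F = 1#
  size₂ 0F 1F = 2#
  size₂ 1F 0F = 2#
  size₂ 1F 1F = 1#

  size₂≤2 : ∀ g e → size₂ g e ≤ 2#
  size₂≤2 0F 0F = 1≤2
  size₂≤2 0F 1F = ≤-refl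
  size₂≤2 1F 0F = ≤-refl
  size₂≤2 1F 1F = 1≤2

  size₂-opposite : ∀ e → size₂ (opposite e) e ≈ 2#
  size₂-opposite 0F = refl
  size₂-opposite 1F = refl

  size₂-opposite⁻ : ∀ e u → size₂ (opposite e) u ≈ 2# → u ≡ e
  size₂-opposite⁻ 0F 0F _   = ≡.refl
  size₂-opposite⁻ 0F 1F 1≈2 = contradiction 1≈2 1≉2
  size₂-opposite⁻ 1F 0F 1≈2 = contradiction 1≈2 1≉2
  size₂-opposite⁻ 1F 1F _   = ≡.refl

  size₂-sum : ∀ g e → size₂ g e + size₂ (opposite g) e ≈ 1# + 2#
  size₂-sum 0F 0F = refl
  size₂-sum 0F 1F = +-comm _ _
  size₂-sum 1F 0F = +-comm _ _
  size₂-sum 1F 1F = refl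

  scale : Fin (4 ℕ.+ r) → Fin 2 → ℝ
  scale 0F e = size₂ 0F e
  scale 1F e = size₂ 0F e
  scale 2F e = size₂ 1F e
  scale 3F e = size₂ 1F e
  scale (suc (suc (suc (suc _)))) _ = 1#

  main : Fin 2 → Fin 2 → Fin (4 ℕ.+ r)
  main 0F 0F = 0F
  main 0F 1F = 1F
  main 1F 0F = 2F
  main 1F 1F = 3F

  scale-main : ∀ g i e → scale (main g i) e ≡ size₂ g e
  scale-main 0F 0F e = ≡.refl
  scale-main 0F 1F e = ≡.refl
  scale-main 1F 0F e = ≡.refl
  scale-main 1F 1F e = ≡.refl

  main-or-unit : ∀ l → (∃[ g ] ∃[ i ] l ≡ main g i) ⊎ (∀ e → scale l e ≡ 1#)
  main-or-unit 0F = inj₁ (0F , 0F , ≡.refl)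
  main-or-unit 1F = inj₁ (0F , 1F , ≡.refl)
  main-or-unit 2F = inj₁ (1F , 0F , ≡.refl)
  main-or-unit 3F = inj₁ (1F , 1F , ≡.refl)
  main-or-unit (suc (suc (suc (suc _)))) = inj₂ λ _ → ≡.refl

  -- The purpose of having two coordinates in each group: an edge flips the sign of at most one of
  -- them.
  main-avoiding : ∀ g k → ∃[ i ] suc (main g i) ≢ k
  main-avoiding g k with suc (main g 0F) Fin.≟ k
  ... | no  ≢k     = 0F , ≢k
  ... | yes ≡.refl = 1F , distinct g
    where
    distinct : ∀ g → suc (main g 1F) ≢ suc (main g 0F)
    distinct 0F ()
    distinct 1F ()

  1or2 : ∀ g e → size₂ g e ≡ 1# ⊎ size₂ g e ≡ 2#
  1or2 0F 0F = inj₁ ≡.refl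
  1or2 0F 1F = inj₂ ≡.refl
  1or2 1F 0F = inj₂ ≡.refl
  1or2 1F 1F = inj₁ ≡.refl

  scale-1or2 : ∀ l e → scale l e ≡ 1# ⊎ scale l e ≡ 2#
  scale-1or2 0F e = 1or2 0F e
  scale-1or2 1F e = 1or2 0F e
  scale-1or2 2F e = 1or2 1F e
  scale-1or2 3F e = 1or2 1F e
  scale-1or2 (suc (suc (suc (suc _)))) _ = inj₁ ≡.refl

  0≤scale : ∀ l e → 0# ≤ scale l e
  0≤scale l e = [ (λ eq → ≡.subst (0# ≤_) (≡.sym eq) 0≤1)
                , (λ eq → ≡.subst (0# ≤_) (≡.sym eq) 0≤2) ]′ (scale-1or2 l e)

  scale≉0 : ∀ l e → ¬ scale l e ≈ 0#
  scale≉0 l e = [ (λ eq → 1≉0 ∘ ≡.subst (_≈ 0#) eq)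
                , (λ eq → 2≉0 ∘ ≡.subst (_≈ 0#) eq) ]′ (scale-1or2 l e)

  -- Bit 0 carries no coordinate of its own; it gets the positive default 1.
  bitScale : Fin (5 ℕ.+ r) → Fin 2 → ℝ
  bitScale zero    _ = 1#
  bitScale (suc l) e = scale l e

  sgn : Fin 2 → ℝ
  sgn 0F = - 1#
  sgn 1F = 1#

  sgn-≡ : ∀ β → sgn β * sgn β ≈ 1#
  sgn-≡ 0F = trans (sym (-‿distribˡ-* 1# (- 1#))) (trans (-‿cong (*-identityˡ _)) (-‿involutive 1#))
  sgn-≡ 1F = *-identityˡ 1#

  sgn-≢ : ∀ {β η} → η ≢ β → sgn β * sgn η ≈ - 1#
  sgn-≢ {0F} {0F} η≢β = contradiction ≡.refl η≢β
  sgn-≢ {0F} {1F} η≢β = *-identityʳ _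
  sgn-≢ {1F} {0F} η≢β = *-identityˡ _
  sgn-≢ {1F} {1F} η≢β = contradiction ≡.refl η≢β

  point : Fin (2 ^ (5 ℕ.+ r)) → Point (4 ℕ.+ r)
  point S l = scale l (bits S 0F) * sgn (bits S (suc l))

  term : Fin 2 → Fin (4 ℕ.+ r) → Fin (2 ^ (5 ℕ.+ r)) → ℝ
  term β l S = axis (sgn β) l · point S

  private
    term-value : ∀ β l S → term β l S ≈ scale l (bits S 0F) * (sgn β * sgn (bits S (suc l)))
    term-value β l S = trans (axis-· (sgn β) l (point S)) (x∙yz≈y∙xz _ _ _)

  term-≡ : ∀ {β} l S → bits S (suc l) ≡ β → term β l S ≈ scale l (bits S 0F)
  term-≡ {β} l S ≡.refl = trans (term-value β l S) (trans (*-congˡ (sgn-≡ β)) (*-identityʳ _))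

  term-≢ : ∀ {β} l S → bits S (suc l) ≢ β → term β l S ≈ - scale l (bits S 0F)
  term-≢ {β} l S ≢β = trans (term-value β l S)
    (trans (*-congˡ (sgn-≢ ≢β)) (trans (sym (-‿distribʳ-* _ _)) (-‿cong (*-identityʳ _))))

  term-≤ : ∀ β l S → term β l S ≤ scale l (bits S 0F)
  term-≤ β l S with bits S (suc l) Fin.≟ β
  ... | yes ≡β = ≤-reflexive (term-≡ l S ≡β)
  ... | no  ≢β = ≤-trans (≤-reflexive (term-≢ l S ≢β)) (-x≤x (0≤scale l (bits S 0F)))

  term-tight : ∀ {β} l S → term β l S ≈ scale l (bits S 0F) → bits S (suc l) ≡ β
  term-tight {β} l S eq = decidable-stable (_ Fin.≟ β) λ ≢β →
    scale≉0 l (bits S 0F) (-x≈x⇒x≈0 (0≤scale l (bits S 0F)) (trans (sym (term-≢ l S ≢β)) eq))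

  -- Tightness closes two gaps at once: the term equals its scale, which fixes the sign bit, and the
  -- scale equals `B`, which fixes t when the scale varies.
  module Single (β : Fin 2) (l : Fin (4 ℕ.+ r)) (B : ℝ) (scale≤B : ∀ e → scale l e ≤ B) where

    inequality : Inequality point
    inequality = record
      { normal = axis (sgn β) l
      ; bound  = B
      ; valid  = λ S → ≤-trans (term-≤ β l S) (scale≤B _)
      }

    tight : ∀ S → bits S (suc l) ≡ β → scale l (bits S 0F) ≈ B → Tight inequality S
    tight S eq = trans (term-≡ l S eq)

    tight-bit : ∀ S → Tight inequality S → bits S (suc l) ≡ β
    tight-bit S tS = term-tight l S (≤-antisym (term-≤ β l S) (≤-trans (scale≤B _) (≤-reflexive (sym tS))))

    tight-scale : ∀ S → Tight inequality S → scale l (bits S 0F) ≈ B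
    tight-scale S tS = ≤-antisym (scale≤B _) (≤-trans (≤-reflexive (sym tS)) (term-≤ β l S))

  module Double (β : Fin 2) (l : Fin (4 ℕ.+ r)) (β′ : Fin 2) (l′ : Fin (4 ℕ.+ r)) (B : ℝ)
                (scale+scale≈B : ∀ e → scale l e + scale l′ e ≈ B) where

    private
      value : ∀ S → (λ j → axis (sgn β) l j + axis (sgn β′) l′ j) · point S ≈ term β l S + term β′ l′ S
      value S = trans (sum-cong-≋ (λ j → distribʳ (point S j) (axis (sgn β) l j) (axis (sgn β′) l′ j)))
        (∑-distrib-+ (λ j → axis (sgn β) l j * point S j) (λ j → axis (sgn β′) l′ j * point S j))

    inequality : Inequality point
    inequality = record
      { normal = λ j → axis (sgn β) l j + axis (sgn β′) l′ j
      ; bound  = B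
      ; valid  = λ S → ≤-trans (≤-reflexive (value S))
          (≤-trans (+-mono-≤ (term-≤ β l S) (term-≤ β′ l′ S)) (≤-reflexive (scale+scale≈B _)))
      }

    tight : ∀ S → bits S (suc l) ≡ β → bits S (suc l′) ≡ β′ → Tight inequality S
    tight S eq eq′ = trans (value S) (trans (+-cong (term-≡ l S eq) (term-≡ l′ S eq′)) (scale+scale≈B _))

    tight-bit : ∀ S → Tight inequality S → bits S (suc l) ≡ β
    tight-bit S tS = term-tight l S (+-tightˡ (term-≤ β l S) (term-≤ β′ l′ S)
      (trans (sym (value S)) (trans tS (sym (scale+scale≈B _)))))

  forces : ∀ {S T} → S ~ T → ∀ k → bits S k ≡ bits T k → ForcesBit point S T k
  forces {S} {T} (k₀ , near) zero eq =
      inequality , tight S ≡.refl (scale≈2 S ≡.refl) , tight T (≡.sym (near _ (proj₂ avoiding))) (scale≈2 T eq) ,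
      λ U tU → size₂-opposite⁻ e (bits U 0F) (trans (reflexive (≡.sym (scale-main g i _))) (tight-scale U tU))
    where
    e = bits S 0F
    -- The group that has scale 2 at the common value `e` of t and scale 1 at the other value.
    g = opposite e
    avoiding = main-avoiding g k₀
    i = proj₁ avoiding
    open Single (bits S (suc (main g i))) (main g i) 2#
      (λ u → ≡.subst (_≤ 2#) (≡.sym (scale-main g i u)) (size₂≤2 g u))

    scale≈2 : ∀ U → e ≡ bits U 0F → scale (main g i) (bits U 0F) ≈ 2#
    scale≈2 U eq = trans (reflexive (≡.trans (scale-main g i _) (≡.cong (size₂ g) (≡.sym eq)))) (size₂-opposite e)
  forces {S} {T} (k₀ , near) (suc l) eq with main-or-unit l
  ... | inj₂ unit = inequality , tight S ≡.refl (reflexive (unit _)) , tight T (≡.sym eq) (reflexive (unit _)) , tight-bit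
    where
    open Single (bits S (suc l)) l 1# (λ e → ≤-reflexive (reflexive (unit e)))
  ... | inj₁ (g , i , ≡.refl) = inequality , tight S ≡.refl ≡.refl ,
      tight T (≡.sym eq) (≡.sym (near _ (proj₂ avoiding))) , tight-bit
    where
    -- The partner comes from the other group, to make the scales add up to 3, and avoids `k₀`, so
    -- that its sign is the same at both ends.
    avoiding = main-avoiding (opposite g) k₀
    i′ = proj₁ avoiding
    open Double (bits S (suc (main g i))) (main g i)
      (bits S (suc (main (opposite g) i′))) (main (opposite g) i′) (1# + 2#)
      (λ e → trans (reflexive (≡.cong₂ _+_ (scale-main g i e) (scale-main (opposite g) i′ e))) (size₂-sum g e))

  twisted : Polytope
  twisted = record { points = point }

  twisted-graph : HasGraph point _~_
  twisted-graph = hasGraph suc bitScale sgn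
    (λ { zero _ → 0≤1 ; (suc l) e → 0≤scale l e }) bitScale≉0 (λ _ _ → refl) forces
    where
    bitScale≉0 : ∀ j e → ¬ bitScale j e ≈ 0#
    bitScale≉0 zero    _ = 1≉0
    bitScale≉0 (suc l) e = scale≉0 l e

  twisted-dim : HasDim ⟦ twisted ⟧ (4 ℕ.+ r)
  -- Here 2 is the step from sign -1 to sign 1.
  twisted-dim = fullDim point suc bitScale sgn 2#
    (λ { zero _ → 1≉0 ; (suc l) e → scale≉0 l e })
    (trans (sym (+-identityˡ 1#)) (trans (+-congʳ (sym (-‿inverseˡ 1#))) (+-assoc _ _ _)))
    2≉0 Fin.suc-injective
    (λ i j → reflexive (≡.cong (bitScale j)
      (≡.trans (bits-replace-≢ origin (suc i) 1F {0F} (λ ())) (bits-origin 0F))))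
    (λ _ _ → refl)

mainTheorem4 : (𝓡 : RealField) → let open Polytopes 𝓡 in
    (n : ℕ) → n ≥ 5 → DimensionallyAmbiguous 1 (skeleton 1 (cube n))
mainTheorem4 𝓡 _ (s≤s (s≤s (s≤s (s≤s (s≤s {n = r} z≤n))))) =
    cube (5 ℕ.+ r) , twisted , 5 ℕ.+ r , 4 ℕ.+ r , cube-dim , twisted-dim , ℕ.1+n≢n ,
    skeleton-≅ cube-graph cube-graph , skeleton-≅ twisted-graph cube-graph
  where
  open Polytopes 𝓡 using (cube)
  open BitStrings (4 ℕ.+ r) using (~-refl; _~?_)
  open Skeleta.SameGraph 𝓡 ~-refl _~?_ using (skeleton-≅)
  open CubeGraph 𝓡 (4 ℕ.+ r) using (cube-dim; cube-graph)
  open Twisted 𝓡 r using (twisted; twisted-dim; twisted-graph)
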